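{- Fix an integer $d\geq 5$. For every sufficiently large $n$, there is an $n$-vertex graph $G=(V,E)$ with VC-dimension at most $d$ such that there are no two disjoint subsets $A,B\subset V$ with $|A|,|B|\geq 4n^{4/d}\log n$ for which $(A,B)$ is homogeneous, i.e., for which either $A\times B\subset E$ (every vertex of $A$ adjacent to every vertex of $B$) or no vertex of $A$ is adjacent to any vertex of $B$.
   Context: For a graph $G=(V,E)$ and $v\in V$, $N(v)$ is the set of neighbors of $v$; the VC-dimension of $G$ is the largest $d$ such that some $d$-element $S\subset V$ satisfies: for every $B\subset S$ there is $v\in V$ with $N(v)\cap S=B$. Logarithms are natural. -}

module Defs where

open import Data.Nat as ℕ using (ℕ; zero; suc)
open import Data.Integer using (+_)
open import Data.Rational as ℚ using (ℚ; 0ℚ; 1ℚ; _<_; _*_; _+_)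
open import Data.Bool using (Bool; true; false)
open import Data.Fin using (Fin)
open import Data.Fin.Subset using (Subset; _∈_; _⊆_; _∩_; ∣_∣; ⊥)
open import Data.Vec using (tabulate)
open import Data.Product using (Σ; ∃; ∃-syntax; _×_)
open import Data.Sum using (_⊎_)
open import Relation.Binary.PropositionalEquality using (_≡_)

record Graph (n : ℕ) : Set where
  field
    adj    : Fin n → Fin n → Bool
    sym    : ∀ u v → adj u v ≡ adj v u
    irrefl : ∀ v → adj v v ≡ false
open Graph public

N : ∀ {n} → Graph n → Fin n → Subset n
N G v = tabulate (adj G v)

Shattered : ∀ {n} → Graph n → Subset n → Set
Shattered G S = ∀ B → B ⊆ S → ∃[ v ] (N G v ∩ S ≡ B)

VCdim≤ : ∀ {n} → Graph n → ℕ → Set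
VCdim≤ G d = ∀ S → Shattered G S → ∣ S ∣ ℕ.≤ d

Homogeneous : ∀ {n} → Graph n → Subset n → Subset n → Set
Homogeneous G A B =
  (∀ a b → a ∈ A → b ∈ B → adj G a b ≡ true) ⊎
  (∀ a b → a ∈ A → b ∈ B → adj G a b ≡ false)

_^ℚ_ : ℚ → ℕ → ℚ
s ^ℚ zero  = 1ℚ
s ^ℚ suc k = s * (s ^ℚ k)

expTerm : ℚ → ℕ → ℚ
expTerm s zero    = 1ℚ
expTerm s (suc k) = expTerm s k * s * ((+ 1) ℚ./ suc k)

expPartial : ℚ → ℕ → ℚ
expPartial s zero    = 1ℚ
expPartial s (suc K) = expPartial s K + expTerm s (suc K)

ℕ→ℚ : ℕ → ℚ
ℕ→ℚ m = (+ m) ℚ./ 1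

-- Large d n a  expresses the real inequality  a ≥ 4 · n^(4/d) · ln n  exactly,
-- using only rationals.  With t = a / (4 n^(4/d)) ≥ 0, the inequality is
-- ln n ≤ t, i.e. n ≤ e^t, which holds iff e^s > n for every rational s > t.
-- For rational s > 0:  s > t  ⟺  (4s)^d · n^4 > a^d,  and
-- e^s > n  ⟺  some partial sum of the exponential series exceeds n.
Large : ℕ → ℕ → ℕ → Set
Large d n a =
  ∀ (s : ℚ) → 0ℚ < s →
    (ℕ→ℚ a) ^ℚ d < ((ℕ→ℚ 4 * s) ^ℚ d) * ((ℕ→ℚ n) ^ℚ 4) →
    ∃[ K ] (ℕ→ℚ n < expPartial s K)

{-# OPTIONS --safe #-}

-- Take a random graph with edge probability 1/q, where q = ⌈n^(4/d)⌉, and let s = ⌊d/2⌋ + 1.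
-- The expected number of copies of K_{s,s} is at most n^(2s) q^(−s²) ≤ n^(2s(1 − 2s/d)) < 1/2,
-- and a graph without K_{s,s} has VC-dimension at most d: in a shattered set of at least
-- d + 1 ≥ 2s − 1 points, any s of them have at least s common neighbours.
-- With l = ⌊log₂ n⌋ and m = q(2l + 3), the bound (1 − 1/q)^q ≤ 1/2 makes the expected number of
-- empty pairs of m-sets at most 1/2.  Finally m ≤ 4 n^(4/d) log n for large n, because
-- m ≤ (q − 1)(2l + 4) and (2l + 4)/4 ≤ log n; the latter is read off the partial sums of
-- exp, using exp(1/4) ≤ 4/3.
module Submission where

open import Defs
open import Data.Nat using (ℕ; zero; suc)
open import Data.Product using (∃-syntax; _×_; _,_; proj₁; proj₂; uncurry)
open import Data.Sum using (inj₁; inj₂)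
open import Relation.Binary.PropositionalEquality as ≡ using (_≡_; _≢_; refl; cong; cong₂; subst; subst₂; trans)
open import Relation.Nullary using (¬_; Dec; yes; no; contradiction)

-- Rational arithmetic and partial sums of the exponential series.

module ExponentialSeries where

  open import Data.Nat as ℕ using ()
  import Data.Nat.Properties as ℕ
  open import Data.Integer as ℤ using (+_)
  import Data.Integer.Properties as ℤ
  open import Data.Rational
    using (ℚ; 0ℚ; 1ℚ; _+_; _*_; _≤_; _<_; _/_; -_; toℚᵘ; NonNegative; Positive; nonNegative; positive)
  open import Data.Rational.Properties
  open import Data.Rational.Solver using (module +-*-Solver)
  import Data.Rational.Unnormalised as ℚᵘ
  import Data.Rational.Unnormalised.Properties as ℚᵘ
  open +-*-Solver using (solve; _:+_; _:*_; _:=_; con)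

  ℕ→ℚᵘ : ℕ → ℚᵘ.ℚᵘ
  ℕ→ℚᵘ m = ℚᵘ.mkℚᵘ (+ m) 0

  -- `ℕ→ℚ` normalises by a gcd that is stuck on a variable. Among unnormalised rationals the
  -- denominator is literally 1, so the identities below become integer identities.
  toℚᵘ-ℕ→ℚ : ∀ m → toℚᵘ (ℕ→ℚ m) ℚᵘ.≃ ℕ→ℚᵘ m
  toℚᵘ-ℕ→ℚ m = toℚᵘ-fromℚᵘ (ℕ→ℚᵘ m)

  ℕ→ℚ-* : ∀ m n → ℕ→ℚ (m ℕ.* n) ≡ ℕ→ℚ m * ℕ→ℚ n
  ℕ→ℚ-* m n = toℚᵘ-injective (begin
    toℚᵘ (ℕ→ℚ (m ℕ.* n))                              ≈⟨ toℚᵘ-ℕ→ℚ (m ℕ.* n) ⟩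
    ℕ→ℚᵘ (m ℕ.* n)                                    ≈⟨ ℚᵘ.*≡* (cong (ℤ._* + 1) (ℤ.pos-* m n)) ⟩
    ℕ→ℚᵘ m ℚᵘ.* ℕ→ℚᵘ n                               ≈⟨ ℚᵘ.*-cong (toℚᵘ-ℕ→ℚ m) (toℚᵘ-ℕ→ℚ n) ⟨
    toℚᵘ (ℕ→ℚ m) ℚᵘ.* toℚᵘ (ℕ→ℚ n)        ≈⟨ toℚᵘ-homo-* (ℕ→ℚ m) (ℕ→ℚ n) ⟨
    toℚᵘ (ℕ→ℚ m * ℕ→ℚ n)                ∎)
    where open ℚᵘ.≃-Reasoning

  ℕ→ℚ-suc : ∀ m → ℕ→ℚ (suc m) ≡ ℕ→ℚ m + 1ℚ
  ℕ→ℚ-suc m = toℚᵘ-injective (begin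
    toℚᵘ (ℕ→ℚ (suc m))                              ≈⟨ toℚᵘ-ℕ→ℚ (suc m) ⟩
    ℕ→ℚᵘ (suc m)                                    ≈⟨ ℚᵘ.*≡* (cong (ℤ._* + 1) (trans (cong +_ (ℕ.+-comm 1 m)) (cong (ℤ._+ + 1) (≡.sym (ℤ.*-identityʳ (+ m)))))) ⟩
    ℕ→ℚᵘ m ℚᵘ.+ ℚᵘ.1ℚᵘ                              ≈⟨ ℚᵘ.+-cong (toℚᵘ-ℕ→ℚ m) ℚᵘ.≃-refl ⟨
    toℚᵘ (ℕ→ℚ m) ℚᵘ.+ ℚᵘ.1ℚᵘ        ≈⟨ toℚᵘ-homo-+ (ℕ→ℚ m) 1ℚ ⟨
    toℚᵘ (ℕ→ℚ m + 1ℚ)                ∎)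
    where open ℚᵘ.≃-Reasoning

  ℕ→ℚ-^ : ∀ m k → ℕ→ℚ (m ℕ.^ k) ≡ ℕ→ℚ m ^ℚ k
  ℕ→ℚ-^ m zero    = refl
  ℕ→ℚ-^ m (suc k) = trans (ℕ→ℚ-* m (m ℕ.^ k)) (cong (ℕ→ℚ m *_) (ℕ→ℚ-^ m k))

  ℕ→ℚ-mono-< : ∀ {m n} → m ℕ.< n → ℕ→ℚ m < ℕ→ℚ n
  ℕ→ℚ-mono-< {m} {n} m<n = toℚᵘ-cancel-<
    (ℚᵘ.<-respˡ-≃ (ℚᵘ.≃-sym (toℚᵘ-ℕ→ℚ m)) (ℚᵘ.<-respʳ-≃ (ℚᵘ.≃-sym (toℚᵘ-ℕ→ℚ n))
      (ℚᵘ.*<* (subst₂ ℤ._<_ (≡.sym (ℤ.*-identityʳ (+ m))) (≡.sym (ℤ.*-identityʳ (+ n))) (ℤ.+<+ m<n)))))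

  ℕ→ℚ-mono-≤ : ∀ {m n} → m ℕ.≤ n → ℕ→ℚ m ≤ ℕ→ℚ n
  ℕ→ℚ-mono-≤ {m} {n} m≤n with ℕ.m≤n⇒m<n∨m≡n m≤n
  ... | inj₁ m<n  = <⇒≤ (ℕ→ℚ-mono-< m<n)
  ... | inj₂ refl = ≤-refl

  ℕ→ℚ-nonNeg : ∀ m → NonNegative (ℕ→ℚ m)
  ℕ→ℚ-nonNeg m = normalize-nonNeg m 1

  ℕ→ℚ-pos : ∀ m → Positive (ℕ→ℚ (suc m))
  ℕ→ℚ-pos m = normalize-pos (suc m) 1

  1/k*k : ∀ k → ((+ 1) / suc k) * ℕ→ℚ (suc k) ≡ 1ℚ
  1/k*k k = toℚᵘ-injective (begin
    toℚᵘ (((+ 1) / suc k) * ℕ→ℚ (suc k))    ≈⟨ toℚᵘ-homo-* ((+ 1) / suc k) (ℕ→ℚ (suc k)) ⟩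
    toℚᵘ ((+ 1) / suc k) ℚᵘ.* toℚᵘ (ℕ→ℚ (suc k))
      ≈⟨ ℚᵘ.*-cong (toℚᵘ-fromℚᵘ (ℚᵘ.mkℚᵘ (+ 1) k)) (toℚᵘ-ℕ→ℚ (suc k)) ⟩
    ℚᵘ.mkℚᵘ (+ 1) k ℚᵘ.* ℕ→ℚᵘ (suc k)
      ≈⟨ ℚᵘ.*≡* (cong +_ (cong suc (trans (ℕ.*-identityʳ _) (trans (ℕ.+-identityʳ k) (≡.sym (trans (ℕ.+-identityʳ _) (ℕ.*-identityʳ k))))))) ⟩
    ℚᵘ.1ℚᵘ ∎)
    where open ℚᵘ.≃-Reasoning

  -- The recurrence of the terms with the division cleared; factorials enter the estimates only in
  -- this form.
  expTerm-suc : ∀ s k → expTerm s (suc k) * ℕ→ℚ (suc k) ≡ expTerm s k * s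
  expTerm-suc s k = begin
    expTerm s k * s * ((+ 1) / suc k) * ℕ→ℚ (suc k)    ≡⟨ *-assoc (expTerm s k * s) _ _ ⟩
    expTerm s k * s * (((+ 1) / suc k) * ℕ→ℚ (suc k))  ≡⟨ cong (expTerm s k * s *_) (1/k*k k) ⟩
    expTerm s k * s * 1ℚ                               ≡⟨ *-identityʳ _ ⟩
    expTerm s k * s                                    ∎
    where open ≡.≡-Reasoning

  *-mono-≤-0 : ∀ {p q} → 0ℚ ≤ p → 0ℚ ≤ q → 0ℚ ≤ p * q
  *-mono-≤-0 {p} {q} 0≤p 0≤q =
    nonNegative⁻¹ (p * q) {{nonNeg*nonNeg⇒nonNeg p {{nonNegative 0≤p}} q {{nonNegative 0≤q}}}}

  expTerm-nonNeg : ∀ {s} → 0ℚ ≤ s → ∀ k → 0ℚ ≤ expTerm s k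
  expTerm-nonNeg 0≤s zero    = nonNegative⁻¹ 1ℚ
  expTerm-nonNeg 0≤s (suc k) =
    *-mono-≤-0 (*-mono-≤-0 (expTerm-nonNeg 0≤s k) 0≤s) (nonNegative⁻¹ _ {{normalize-nonNeg 1 (suc k)}})

  p≤p+q : ∀ p {q} → 0ℚ ≤ q → p ≤ p + q
  p≤p+q p 0≤q = ≤-trans (≤-reflexive (≡.sym (+-identityʳ p))) (+-monoʳ-≤ p 0≤q)

  0≤p+q : ∀ {p q} → 0ℚ ≤ p → 0ℚ ≤ q → 0ℚ ≤ p + q
  0≤p+q 0≤p 0≤q = ≤-trans 0≤p (p≤p+q _ 0≤q)

  -- Convexity of s ↦ sᵏ/k!, whose derivative is the preceding term.
  expTerm-+ : ∀ {s y} → 0ℚ ≤ s → 0ℚ ≤ y → ∀ k →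
              expTerm (s + y) (suc k) ≤ expTerm s (suc k) + y * expTerm (s + y) k
  expTerm-+ {s} {y} 0≤s 0≤y zero = ≤-reflexive
    (solve 2 (λ s y → con 1ℚ :* (s :+ y) :* con 1ℚ := con 1ℚ :* s :* con 1ℚ :+ y :* con 1ℚ) refl s y)
  expTerm-+ {s} {y} 0≤s 0≤y (suc k) =
    *-cancelʳ-≤-pos (ℕ→ℚ (suc (suc k))) {{ℕ→ℚ-pos (suc k)}} (begin
      expTerm (s + y) (suc (suc k)) * ℕ→ℚ (suc (suc k))   ≡⟨ expTerm-suc (s + y) (suc k) ⟩
      b * (s + y)                                          ≡⟨ *-distribˡ-+ b s y ⟩
      b * s + b * y                                        ≤⟨ +-monoˡ-≤ (b * y) (*-monoʳ-≤-nonNeg s {{nonNegative 0≤s}} (expTerm-+ 0≤s 0≤y k)) ⟩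
      (c + y * a) * s + b * y                              ≡⟨ solve 5 (λ a b c s y → (c :+ y :* a) :* s :+ b :* y := c :* s :+ b :* y :+ a :* y :* s) refl a b c s y ⟩
      -- Enlarging `s` to `s + y` lets the recurrence turn `a * (s + y)` into `b * n1`; together
      -- with `b * y` this makes `n1 + 1ℚ`, that is `n2`, copies of `y * b`.
      c * s + b * y + a * y * s                            ≤⟨ +-monoʳ-≤ (c * s + b * y) (*-monoˡ-≤-nonNeg (a * y) {{nonNegative (*-mono-≤-0 (expTerm-nonNeg (0≤p+q 0≤s 0≤y) k) 0≤y)}} (p≤p+q s 0≤y)) ⟩
      c * s + b * y + a * y * (s + y)                      ≡⟨ solve 5 (λ a b c s y → c :* s :+ b :* y :+ a :* y :* (s :+ y) := c :* s :+ b :* y :+ a :* (s :+ y) :* y) refl a b c s y ⟩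
      c * s + b * y + a * (s + y) * y                      ≡⟨ cong₂ (λ u v → u + b * y + v * y) (≡.sym (expTerm-suc s (suc k))) (≡.sym (expTerm-suc (s + y) k)) ⟩
      d * n2 + b * y + b * n1 * y                          ≡⟨ cong (λ u → d * u + b * y + b * n1 * y) (ℕ→ℚ-suc (suc k)) ⟩
      d * (n1 + 1ℚ) + b * y + b * n1 * y                   ≡⟨ solve 4 (λ b d n y → d :* (n :+ con 1ℚ) :+ b :* y :+ b :* n :* y := (d :+ y :* b) :* (n :+ con 1ℚ)) refl b d n1 y ⟩
      (d + y * b) * (n1 + 1ℚ)                              ≡⟨ cong ((d + y * b) *_) (ℕ→ℚ-suc (suc k)) ⟨
      (d + y * b) * n2                                     ∎)
    where
    open ≤-Reasoning
    a = expTerm (s + y) k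
    b = expTerm (s + y) (suc k)
    c = expTerm s (suc k)
    d = expTerm s (suc (suc k))
    n1 = ℕ→ℚ (suc k)
    n2 = ℕ→ℚ (suc (suc k))

  -- Sum of `expTerm-+` over the terms: the term of order k + 1 on the left is charged to the one of
  -- order k on the right, hence the shift of the index.
  expPartial-suc-+ : ∀ {s y} → 0ℚ ≤ s → 0ℚ ≤ y → ∀ K →
                     expPartial (s + y) (suc K) ≤ expPartial s (suc K) + y * expPartial (s + y) K
  expPartial-suc-+ {s} {y} 0≤s 0≤y zero = begin
    1ℚ + expTerm (s + y) 1                    ≤⟨ +-monoʳ-≤ 1ℚ (expTerm-+ 0≤s 0≤y 0) ⟩
    1ℚ + (expTerm s 1 + y * 1ℚ)               ≡⟨ +-assoc 1ℚ (expTerm s 1) (y * 1ℚ) ⟨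
    1ℚ + expTerm s 1 + y * 1ℚ                 ∎
    where open ≤-Reasoning
  expPartial-suc-+ {s} {y} 0≤s 0≤y (suc K) = begin
    expPartial (s + y) (suc K) + expTerm (s + y) (suc (suc K))
      ≤⟨ +-mono-≤ (expPartial-suc-+ 0≤s 0≤y K) (expTerm-+ 0≤s 0≤y (suc K)) ⟩
    (expPartial s (suc K) + y * expPartial (s + y) K) + (expTerm s (suc (suc K)) + y * expTerm (s + y) (suc K))
      ≡⟨ solve 5 (λ a b c d y → (a :+ y :* b) :+ (c :+ y :* d) := (a :+ c) :+ y :* (b :+ d)) refl
           (expPartial s (suc K)) (expPartial (s + y) K) (expTerm s (suc (suc K))) (expTerm (s + y) (suc K)) y ⟩
    (expPartial s (suc K) + expTerm s (suc (suc K))) + y * (expPartial (s + y) K + expTerm (s + y) (suc K)) ∎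
    where open ≤-Reasoning

  -- Equal indices on both sides allow the inequality to be solved for `expPartial (s + y) K`,
  -- giving the factor 1/(1 - y) when y < 1.
  expPartial-+ : ∀ {s y} → 0ℚ ≤ s → 0ℚ ≤ y → ∀ K →
                 expPartial (s + y) K ≤ expPartial s K + y * expPartial (s + y) K
  expPartial-+ 0≤s 0≤y zero    = p≤p+q 1ℚ (*-mono-≤-0 0≤y (nonNegative⁻¹ 1ℚ))
  expPartial-+ {s} {y} 0≤s 0≤y (suc K) = ≤-trans (expPartial-suc-+ 0≤s 0≤y K)
    (+-monoʳ-≤ (expPartial s (suc K)) (*-monoˡ-≤-nonNeg y {{nonNegative 0≤y}}
      (p≤p+q (expPartial (s + y) K) (expTerm-nonNeg (0≤p+q 0≤s 0≤y) (suc K)))))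

  ¼ : ℚ
  ¼ = (+ 1) / 4

  -- At y = 1/4, moving `y * u` to the left leaves three quarters of `u`. This is exp(1/4) ≤ 4/3
  -- with the fraction multiplied out.
  expPartial-+¼ : ∀ {s} → 0ℚ ≤ s → ∀ K → ℕ→ℚ 3 * expPartial (s + ¼) K ≤ ℕ→ℚ 4 * expPartial s K
  expPartial-+¼ {s} 0≤s K = begin
    ℕ→ℚ 3 * u
      ≡⟨ solve 1 (λ u → con (ℕ→ℚ 3) :* u := con (ℕ→ℚ 4) :* u :+ con ((- 1ℚ)) :* u) refl u ⟩
    ℕ→ℚ 4 * u + (- 1ℚ) * u
      ≤⟨ +-monoˡ-≤ ((- 1ℚ) * u) (*-monoˡ-≤-nonNeg (ℕ→ℚ 4) (expPartial-+ 0≤s (nonNegative⁻¹ ¼) K)) ⟩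
    ℕ→ℚ 4 * (v + ¼ * u) + (- 1ℚ) * u
      ≡⟨ solve 2 (λ u v → con (ℕ→ℚ 4) :* (v :+ con ¼ :* u) :+ con ((- 1ℚ)) :* u := con (ℕ→ℚ 4) :* v) refl u v ⟩
    ℕ→ℚ 4 * v ∎
    where
    open ≤-Reasoning
    u = expPartial (s + ¼) K
    v = expPartial s K

  expPartial-0 : ∀ K → expPartial 0ℚ K ≡ 1ℚ
  expPartial-0 zero = refl
  expPartial-0 (suc K) = begin
    expPartial 0ℚ K + expTerm 0ℚ K * 0ℚ * ((+ 1) / suc K)
      ≡⟨ solve 3 (λ a b c → a :+ b :* con 0ℚ :* c := a) refl (expPartial 0ℚ K) (expTerm 0ℚ K) ((+ 1) / suc K) ⟩
    expPartial 0ℚ K                       ≡⟨ expPartial-0 K ⟩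
    1ℚ                                    ∎
    where open ≡.≡-Reasoning

  quarters : ℕ → ℚ
  quarters zero    = 0ℚ
  quarters (suc j) = quarters j + ¼

  quarters-nonNeg : ∀ j → 0ℚ ≤ quarters j
  quarters-nonNeg zero    = ≤-refl
  quarters-nonNeg (suc j) = 0≤p+q (quarters-nonNeg j) (nonNegative⁻¹ ¼)

  4*quarters : ∀ j → ℕ→ℚ 4 * quarters j ≡ ℕ→ℚ j
  4*quarters zero    = refl
  4*quarters (suc j) = begin
    ℕ→ℚ 4 * (quarters j + ¼)   ≡⟨ solve 1 (λ a → con (ℕ→ℚ 4) :* (a :+ con ¼) := con (ℕ→ℚ 4) :* a :+ con 1ℚ) refl (quarters j) ⟩
    ℕ→ℚ 4 * quarters j + 1ℚ    ≡⟨ cong (_+ 1ℚ) (4*quarters j) ⟩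
    ℕ→ℚ j + 1ℚ                 ≡⟨ ℕ→ℚ-suc j ⟨
    ℕ→ℚ (suc j)                ∎
    where open ≡.≡-Reasoning

  -- exp (j/4) ≤ (4/3)ʲ
  expPartial-quarters : ∀ j K → ℕ→ℚ (3 ℕ.^ j) * expPartial (quarters j) K ≤ ℕ→ℚ (4 ℕ.^ j)
  expPartial-quarters zero    K = ≤-reflexive (trans (*-identityˡ _) (expPartial-0 K))
  expPartial-quarters (suc j) K = begin
    ℕ→ℚ (3 ℕ.* 3 ℕ.^ j) * u       ≡⟨ cong (_* u) (ℕ→ℚ-* 3 (3 ℕ.^ j)) ⟩
    ℕ→ℚ 3 * t * u                 ≡⟨ solve 3 (λ a t u → a :* t :* u := t :* (a :* u)) refl (ℕ→ℚ 3) t u ⟩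
    t * (ℕ→ℚ 3 * u)               ≤⟨ *-monoˡ-≤-nonNeg t {{ℕ→ℚ-nonNeg (3 ℕ.^ j)}} (expPartial-+¼ (quarters-nonNeg j) K) ⟩
    t * (ℕ→ℚ 4 * v)               ≡⟨ solve 3 (λ a t u → t :* (a :* u) := a :* (t :* u)) refl (ℕ→ℚ 4) t v ⟩
    ℕ→ℚ 4 * (t * v)               ≤⟨ *-monoˡ-≤-nonNeg (ℕ→ℚ 4) (expPartial-quarters j K) ⟩
    ℕ→ℚ 4 * ℕ→ℚ (4 ℕ.^ j)         ≡⟨ ℕ→ℚ-* 4 (4 ℕ.^ j) ⟨
    ℕ→ℚ (4 ℕ.* 4 ℕ.^ j)           ∎
    where
    open ≤-Reasoning
    t = ℕ→ℚ (3 ℕ.^ j)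
    u = expPartial (quarters (suc j)) K
    v = expPartial (quarters j) K

  -- Large is applied to s = (j + 1)/4, for which exp s ≤ (4/3)ʲ⁺¹ ≤ n.
  Large⇒≥ : ∀ d n a j → Large d n a → 4 ℕ.^ suc j ℕ.≤ 3 ℕ.^ suc j ℕ.* n → suc j ℕ.^ d ℕ.* n ℕ.^ 4 ℕ.≤ a ℕ.^ d
  Large⇒≥ d n a j large 4≤3 = ℕ.≮⇒≥ λ a<j →
    -- As 4s = j + 1, the negation of the conclusion is exactly the premise of `Large` at s.
    let K , n<S = large s 0<s (subst₂ _<_ (ℕ→ℚ-^ a d)
          (trans (ℕ→ℚ-* (suc j ℕ.^ d) (n ℕ.^ 4))
            (cong₂ _*_ (trans (ℕ→ℚ-^ (suc j) d) (cong (_^ℚ d) (≡.sym (4*quarters (suc j))))) (ℕ→ℚ-^ n 4)))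
          (ℕ→ℚ-mono-< a<j))
    in <-irrefl refl (begin-strict
      ℕ→ℚ (4 ℕ.^ suc j)                          ≤⟨ ℕ→ℚ-mono-≤ 4≤3 ⟩
      ℕ→ℚ (3 ℕ.^ suc j ℕ.* n)                    ≡⟨ ℕ→ℚ-* (3 ℕ.^ suc j) n ⟩
      ℕ→ℚ (3 ℕ.^ suc j) * ℕ→ℚ n                  <⟨ *-monoʳ-<-pos (ℕ→ℚ (3 ℕ.^ suc j)) {{positive (ℕ→ℚ-mono-< (ℕ.m^n>0 3 (suc j)))}} n<S ⟩
      ℕ→ℚ (3 ℕ.^ suc j) * expPartial s K         ≤⟨ expPartial-quarters (suc j) K ⟩
      ℕ→ℚ (4 ℕ.^ suc j)                          ∎)
    where
    open ≤-Reasoning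
    s = quarters (suc j)
    0<s : 0ℚ < s
    0<s = ≤-<-trans (quarters-nonNeg j) (<-respˡ-≡ (+-identityʳ (quarters j)) (+-monoʳ-< (quarters j) (positive⁻¹ ¼)))

open ExponentialSeries using (Large⇒≥)
open import Data.Nat using (_+_; _*_; _∸_; _^_; _≤_; _<_; z≤n; s≤s; pred; _<?_; _≤?_; _/_; >-nonZero)
open import Data.Nat.Properties
open import Data.Nat.DivMod using (m/n*n≤m; m≡m%n+[m/n]*n; m%n<n; /-monoˡ-≤; m*n/n≡m)
open import Data.Nat.ListAction using (sum)
open import Data.Nat.Tactic.RingSolver using (solve-∀)
open import Data.Bool using (Bool; true; false)
open import Data.Bool.Properties using () renaming (_≟_ to _≟ᵇ_)
open import Data.Fin using (Fin; zero; suc)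
open import Data.Fin.Subset using (Subset; inside; outside; _∈_; _∉_; _⊆_; _∩_; _∪_; _─_; _-_; ⁅_⁆; ∣_∣; ⊥)
open import Data.Fin.Subset.Properties
open import Data.List as List using (List; []; _∷_; map; length; filter; cartesianProduct)
open import Data.List.Properties using (length-++; length-map; length-filter)
open import Data.List.Membership.Propositional using () renaming (_∈_ to _∈ₗ_)
open import Data.List.Membership.Propositional.Properties
  using (∈-map⁺; ∈-map⁻; ∈-++⁺ˡ; ∈-++⁺ʳ; ∈-++⁻; ∈-cartesianProduct⁺; ∈-cartesianProduct⁻; ∈-filter⁺; ∈-filter⁻)
open import Data.List.Relation.Unary.Any using (here; there)
open import Data.List.Relation.Unary.All as All using (All; []; _∷_)
open import Data.Vec as Vec using (Vec; []; _∷_; _++_; lookup; take; drop; tabulate)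
open import Data.Vec.Properties
  using (≡-dec; ∷-injectiveʳ; lookup∘tabulate; []=⇒lookup; lookup⇒[]=; take++drop≡id)
open import Function using (_∘_; id)
open import Relation.Nullary.Decidable using (does; dec-true)
open import Relation.Unary using (Decidable)

-- The probability space

-- E r M f is (r+1)^M times the expectation of f when each coordinate is
-- independently true with probability 1/(r+1).
E : ℕ → (M : ℕ) → (Vec Bool M → ℕ) → ℕ
E r zero    f = f []
E r (suc M) f = E r M (f ∘ (true ∷_)) + r * E r M (f ∘ (false ∷_))

E-cong : ∀ r M {f g} → (∀ x → f x ≡ g x) → E r M f ≡ E r M g
E-cong r zero    f≗g = f≗g []
E-cong r (suc M) f≗g =
  cong₂ (λ a b → a + r * b) (E-cong r M (f≗g ∘ (true ∷_))) (E-cong r M (f≗g ∘ (false ∷_)))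

E-zero : ∀ r M → E r M (λ _ → 0) ≡ 0
E-zero r zero = refl
E-zero r (suc M) rewrite E-zero r M = *-zeroʳ r

E-+ : ∀ r M f g → E r M (λ x → f x + g x) ≡ E r M f + E r M g
E-+ r zero    f g = refl
E-+ r (suc M) f g
  rewrite E-+ r M (f ∘ (true ∷_)) (g ∘ (true ∷_)) | E-+ r M (f ∘ (false ∷_)) (g ∘ (false ∷_))
  = rearrange (E r M (f ∘ (true ∷_))) (E r M (g ∘ (true ∷_))) r _ _
  where
  rearrange : ∀ a b r c d → (a + b) + r * (c + d) ≡ (a + r * c) + (b + r * d)
  rearrange = solve-∀

E-sum : ∀ {A : Set} r M (h : A → Vec Bool M → ℕ) (ts : List A) →
        E r M (λ x → sum (map (λ t → h t x) ts)) ≡ sum (map (λ t → E r M (h t)) ts)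
E-sum r M h []       = E-zero r M
E-sum r M h (t ∷ ts) = trans (E-+ r M (h t) _) (cong (E r M (h t) +_) (E-sum r M h ts))

-- First-moment method: the weights total `suc r ^ M`, so the mean is below 1. Then so is one of the
-- means conditioned on the first coordinate, and in the end a natural number below 1 is 0.
E<⇒∃zero : ∀ r M f → E r M f < suc r ^ M → ∃[ x ] f x ≡ 0
E<⇒∃zero r zero    f E<1 = [] , n<1⇒n≡0 E<1
E<⇒∃zero r (suc M) f E<  with E r M (f ∘ (true ∷_)) <? suc r ^ M | E r M (f ∘ (false ∷_)) <? suc r ^ M
... | yes p | _     = let x , eq = E<⇒∃zero r M _ p in true ∷ x , eq
... | no _  | yes p = let x , eq = E<⇒∃zero r M _ p in false ∷ x , eq
... | no p  | no p′ = contradiction E< (≤⇒≯ (+-mono-≤ (≮⇒≥ p) (*-monoʳ-≤ r (≮⇒≥ p′))))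

-- Events prescribing one value on a mask of coordinates, and their union bound.

weight : ℕ → Bool → ℕ
weight r true  = 1
weight r false = r

ind : Bool → ∀ {M} → Vec Bool M → Vec Bool M → ℕ
ind c     []          []          = 1
ind c     (false ∷ t) (_     ∷ x) = ind c t x
ind true  (true  ∷ t) (true  ∷ x) = ind true t x
ind true  (true  ∷ t) (false ∷ x) = 0
ind false (true  ∷ t) (true  ∷ x) = 0
ind false (true  ∷ t) (false ∷ x) = ind false t x

-- Independence: an unmasked coordinate contributes the full weight `suc r`, a masked one only
-- `weight r c`. The power of `suc r` on the left avoids a division.
E-ind : ∀ r c {M} (t : Vec Bool M) →
        E r M (ind c t) * suc r ^ ∣ t ∣ ≡ weight r c ^ ∣ t ∣ * suc r ^ M
E-ind r c     []          = refl
E-ind r c {suc M} (false ∷ t) = begin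
  (e + r * e) * suc r ^ ∣ t ∣       ≡⟨ *-assoc (suc r) e _ ⟩
  suc r * (e * suc r ^ ∣ t ∣)       ≡⟨ cong (suc r *_) (E-ind r c t) ⟩
  suc r * (w * suc r ^ M)           ≡⟨ swap (suc r) w (suc r ^ M) ⟩
  w * (suc r * suc r ^ M)           ∎
  where
  open ≡.≡-Reasoning
  e = E r _ (ind c t)
  w = weight r c ^ ∣ t ∣
  swap : ∀ a b c → a * (b * c) ≡ b * (a * c)
  swap = solve-∀
E-ind r true {suc M} (true  ∷ t) rewrite E-zero r M | *-zeroʳ r = begin
  (e + 0) * (suc r * suc r ^ ∣ t ∣)    ≡⟨ swap e (suc r) _ ⟩
  suc r * (e * suc r ^ ∣ t ∣)          ≡⟨ cong (suc r *_) (E-ind r true t) ⟩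
  suc r * (w * suc r ^ M)              ≡⟨ swap′ (suc r) w _ ⟩
  (1 * w) * (suc r * suc r ^ M)        ∎
  where
  open ≡.≡-Reasoning
  e = E r _ (ind true t)
  w = 1 ^ ∣ t ∣
  swap : ∀ a b c → (a + 0) * (b * c) ≡ b * (a * c)
  swap = solve-∀
  swap′ : ∀ a b c → a * (b * c) ≡ (1 * b) * (a * c)
  swap′ = solve-∀
E-ind r false {suc M} (true  ∷ t) rewrite E-zero r M = begin
  (r * e) * (suc r * suc r ^ ∣ t ∣)    ≡⟨ swap r e (suc r) _ ⟩
  r * suc r * (e * suc r ^ ∣ t ∣)      ≡⟨ cong (r * suc r *_) (E-ind r false t) ⟩
  r * suc r * (w * suc r ^ M)          ≡⟨ swap′ r (suc r) w _ ⟩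
  (r * w) * (suc r * suc r ^ M)        ∎
  where
  open ≡.≡-Reasoning
  e = E r _ (ind false t)
  w = r ^ ∣ t ∣
  swap : ∀ d a b c → (d * a) * (b * c) ≡ d * b * (a * c)
  swap = solve-∀
  swap′ : ∀ d a b c → d * a * (b * c) ≡ (d * b) * (a * c)
  swap′ = solve-∀

-- The event whose indicator is `ind`. The inductive form follows the concatenated rows of a graph
-- vector, so it composes along `++`.
data Mono (c : Bool) : ∀ {M} → Vec Bool M → Vec Bool M → Set where
  []    : Mono c [] []
  free  : ∀ {M y} {t x : Vec Bool M} → Mono c t x → Mono c (false ∷ t) (y ∷ x)
  fixed : ∀ {M} {t x : Vec Bool M} → Mono c t x → Mono c (true ∷ t) (c ∷ x)

ind-Mono : ∀ {c M} {t x : Vec Bool M} → Mono c t x → ind c t x ≡ 1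
ind-Mono              []        = refl
ind-Mono              (free p)  = ind-Mono p
ind-Mono {c = true}   (fixed p) = ind-Mono p
ind-Mono {c = false}  (fixed p) = ind-Mono p

sum-ind≡0 : ∀ c {M} (ts : List (Vec Bool M)) x → sum (map (λ t → ind c t x) ts) ≡ 0 →
            ∀ {t} → t ∈ₗ ts → ¬ Mono c t x
sum-ind≡0 c (t ∷ ts) x eq (here refl) p = contradiction (trans (≡.sym (ind-Mono p)) (m+n≡0⇒m≡0 _ eq)) λ ()
sum-ind≡0 c (t ∷ ts) x eq (there t∈)  p = sum-ind≡0 c ts x (m+n≡0⇒n≡0 (ind c t x) eq) t∈ p

sum-E-ind : ∀ r c {M} k (ts : List (Vec Bool M)) → All (λ t → ∣ t ∣ ≡ k) ts →
            sum (map (λ t → E r M (ind c t)) ts) * suc r ^ k ≡ length ts * (weight r c ^ k * suc r ^ M)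
sum-E-ind r c k []       []           = refl
sum-E-ind r c k (t ∷ ts) (refl ∷ eqs) =
  trans (*-distribʳ-+ (suc r ^ ∣ t ∣) (E r _ (ind c t)) _)
        (cong₂ _+_ (E-ind r c t) (sum-E-ind r c k ts eqs))

-- Union bound: each of the two families of events has total probability at most 1/2.
avoid : ∀ r {M} k k′ (ts ts′ : List (Vec Bool M)) →
        All (λ t → ∣ t ∣ ≡ k) ts → All (λ t → ∣ t ∣ ≡ k′) ts′ →
        2 * length ts < suc r ^ k →
        2 * (length ts′ * r ^ k′) ≤ suc r ^ k′ →
        ∃[ x ] (∀ {t} → t ∈ₗ ts → ¬ Mono true t x) × (∀ {t} → t ∈ₗ ts′ → ¬ Mono false t x)
avoid r {M} k k′ ts ts′ sizes sizes′ few few′ =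
  x , sum-ind≡0 true ts x (m+n≡0⇒m≡0 _ fx≡0) , sum-ind≡0 false ts′ x (m+n≡0⇒n≡0 (F true ts x) fx≡0)
  where
  open ≤-Reasoning
  q = suc r
  F : Bool → List (Vec Bool M) → Vec Bool M → ℕ
  F c us y = sum (map (λ t → ind c t y) us)
  e e′ : ℕ
  e  = sum (map (λ t → E r M (ind true t)) ts)
  e′ = sum (map (λ t → E r M (ind false t)) ts′)
  e< : 2 * e < q ^ M
  e< = *-cancelʳ-< (q ^ k) (2 * e) (q ^ M) (begin-strict
    2 * e * q ^ k                            ≡⟨ *-assoc 2 e _ ⟩
    2 * (e * q ^ k)                          ≡⟨ cong (2 *_) (sum-E-ind r true k ts sizes) ⟩
    2 * (length ts * (1 ^ k * q ^ M))        ≡⟨ cong (λ z → 2 * (length ts * (z * q ^ M))) (^-zeroˡ k) ⟩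
    2 * (length ts * (1 * q ^ M))            ≡⟨ lemma (length ts) (q ^ M) ⟩
    2 * length ts * q ^ M                    <⟨ *-monoˡ-< (q ^ M) {{m^n≢0 q M}} few ⟩
    q ^ k * q ^ M                            ≡⟨ *-comm (q ^ k) _ ⟩
    q ^ M * q ^ k                            ∎)
    where
    lemma : ∀ a b → 2 * (a * (1 * b)) ≡ 2 * a * b
    lemma = solve-∀
  e′≤ : 2 * e′ ≤ q ^ M
  e′≤ = *-cancelʳ-≤ (2 * e′) (q ^ M) (q ^ k′) {{m^n≢0 q k′}} (begin
    2 * e′ * q ^ k′                            ≡⟨ *-assoc 2 e′ _ ⟩
    2 * (e′ * q ^ k′)                          ≡⟨ cong (2 *_) (sum-E-ind r false k′ ts′ sizes′) ⟩
    2 * (length ts′ * (r ^ k′ * q ^ M))        ≡⟨ lemma (length ts′) (r ^ k′) (q ^ M) ⟩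
    2 * (length ts′ * r ^ k′) * q ^ M          ≤⟨ *-monoˡ-≤ (q ^ M) few′ ⟩
    q ^ k′ * q ^ M                             ≡⟨ *-comm (q ^ k′) _ ⟩
    q ^ M * q ^ k′                             ∎)
    where
    lemma : ∀ a b c → 2 * (a * (b * c)) ≡ 2 * (a * b) * c
    lemma = solve-∀
  total : E r M (λ y → F true ts y + F false ts′ y) < q ^ M
  total = *-cancelˡ-< 2 _ _ (begin-strict
    2 * E r M (λ y → F true ts y + F false ts′ y)
      ≡⟨ cong (2 *_) (trans (E-+ r M (F true ts) (F false ts′)) (cong₂ _+_ (E-sum r M (ind true) ts) (E-sum r M (ind false) ts′))) ⟩
    2 * (e + e′)            ≡⟨ *-distribˡ-+ 2 e e′ ⟩
    2 * e + 2 * e′          <⟨ +-mono-<-≤ e< e′≤ ⟩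
    q ^ M + q ^ M           ≡⟨ cong (q ^ M +_) (+-identityʳ _) ⟨
    2 * q ^ M               ∎)
  found = E<⇒∃zero r M _ total
  x = proj₁ found
  fx≡0 = proj₂ found

-- Graphs as bit vectors: each vertex lists its adjacencies to the later vertices

-- The binomial coefficient "n choose 2": one coordinate per potential edge.
tri : ℕ → ℕ
tri zero    = 0
tri (suc n) = n + tri n

adjᵗ : ∀ n → Vec Bool (tri n) → Fin n → Fin n → Bool
adjᵗ (suc n) x zero    zero    = false
adjᵗ (suc n) x zero    (suc j) = lookup (take n x) j
adjᵗ (suc n) x (suc i) zero    = lookup (take n x) i
adjᵗ (suc n) x (suc i) (suc j) = adjᵗ n (drop n x) i j

adjᵗ-sym : ∀ n (x : Vec Bool (tri n)) i j → adjᵗ n x i j ≡ adjᵗ n x j i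
adjᵗ-sym (suc n) x zero    zero    = refl
adjᵗ-sym (suc n) x zero    (suc j) = refl
adjᵗ-sym (suc n) x (suc i) zero    = refl
adjᵗ-sym (suc n) x (suc i) (suc j) = adjᵗ-sym n (drop n x) i j

adjᵗ-irrefl : ∀ n (x : Vec Bool (tri n)) i → adjᵗ n x i i ≡ false
adjᵗ-irrefl (suc n) x zero    = refl
adjᵗ-irrefl (suc n) x (suc i) = adjᵗ-irrefl n (drop n x) i

graph : ∀ n → Vec Bool (tri n) → Graph n
graph n x = record { adj = adjᵗ n x ; sym = adjᵗ-sym n x ; irrefl = adjᵗ-irrefl n x }

-- Masks of the edges between two vertex sets.

between₀ : ∀ {n} → Bool → Bool → Subset n → Subset n → Subset n
-- The row of the first vertex. For a vertex in both sets recording `B` is a mere default: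
-- disjointness excludes this case from the count.
between₀ true  _     A B = B
between₀ false true  A B = A
between₀ false false A B = ⊥

between : ∀ {n} → Subset n → Subset n → Vec Bool (tri n)
between []      []      = []
between (a ∷ A) (b ∷ B) = between₀ a b A B ++ between A B

∣++∣ : ∀ {m n} (p : Subset m) (q : Subset n) → ∣ p ++ q ∣ ≡ ∣ p ∣ + ∣ q ∣
∣++∣ []          q = refl
∣++∣ (true  ∷ p) q = cong suc (∣++∣ p q)
∣++∣ (false ∷ p) q = ∣++∣ p q

-- Each pair is recorded in the row of its earlier endpoint; disjointness rules out loops and edges
-- that would arise in both orders.
∣between∣ : ∀ {n} (A B : Subset n) → A ∩ B ≡ ⊥ → ∣ between A B ∣ ≡ ∣ A ∣ * ∣ B ∣
∣between∣ []          []          _    = refl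
∣between∣ (true  ∷ A) (true  ∷ B) ()
∣between∣ (true  ∷ A) (false ∷ B) disj =
  trans (∣++∣ B (between A B)) (cong (∣ B ∣ +_) (∣between∣ A B (∷-injectiveʳ disj)))
∣between∣ (false ∷ A) (true  ∷ B) disj =
  trans (∣++∣ A (between A B))
        (trans (cong (∣ A ∣ +_) (∣between∣ A B (∷-injectiveʳ disj))) (≡.sym (*-suc ∣ A ∣ ∣ B ∣)))
∣between∣ {suc n} (false ∷ A) (false ∷ B) disj =
  trans (∣++∣ {n} ⊥ (between A B))
        (trans (cong (_+ ∣ between A B ∣) (∣⊥∣≡0 n)) (∣between∣ A B (∷-injectiveʳ disj)))

Mono-++ : ∀ {c m n} {t x : Vec Bool m} {t′ x′ : Vec Bool n} →
          Mono c t x → Mono c t′ x′ → Mono c (t ++ t′) (x ++ x′)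
Mono-++ []        q = q
Mono-++ (free p)  q = free (Mono-++ p q)
Mono-++ (fixed p) q = fixed (Mono-++ p q)

Mono-lookup : ∀ {c n} (t x : Vec Bool n) → (∀ i → i ∈ t → lookup x i ≡ c) → Mono c t x
Mono-lookup []          []      h = []
Mono-lookup (false ∷ t) (y ∷ x) h = free (Mono-lookup t x λ i i∈ → h (suc i) (Vec.there i∈))
Mono-lookup (true  ∷ t) (y ∷ x) h with refl ← h zero Vec.here =
  fixed (Mono-lookup t x λ i i∈ → h (suc i) (Vec.there i∈))

Mono-between : ∀ {c n} (A B : Subset n) (x : Vec Bool (tri n)) →
               (∀ a b → a ∈ A → b ∈ B → adjᵗ n x a b ≡ c) → Mono c (between A B) x
Mono-between [] [] [] h = []
Mono-between {c} {suc n} (a ∷ A) (b ∷ B) x h =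
  subst (Mono c (between (a ∷ A) (b ∷ B))) (take++drop≡id n x)
    (Mono-++ (Mono-lookup (between₀ a b A B) (take n x) (row a b h))
             (Mono-between A B (drop n x) λ i j i∈ j∈ → h (suc i) (suc j) (Vec.there i∈) (Vec.there j∈)))
  where
  row : ∀ a b → (∀ i j → i ∈ a ∷ A → j ∈ b ∷ B → adjᵗ (suc n) x i j ≡ c) →
        ∀ i → i ∈ between₀ a b A B → lookup (take n x) i ≡ c
  row true  _     h i i∈ = h zero (suc i) Vec.here (Vec.there i∈)
  row false true  h i i∈ = h (suc i) zero (Vec.there i∈) Vec.here
  row false false h i i∈ = contradiction i∈ ∉⊥

-- Listing the sets of a given size and the events of their pairs.

sized : ∀ n → ℕ → List (Subset n)
sized zero    zero    = [] ∷ []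
sized zero    (suc k) = []
sized (suc n) zero    = map (outside ∷_) (sized n zero)
sized (suc n) (suc k) = map (inside ∷_) (sized n k) List.++ map (outside ∷_) (sized n (suc k))

-- Pascal's recursion, with the crude bound `n ^ k + n * n ^ k` for the two branches.
length-sized : ∀ n k → length (sized n k) ≤ n ^ k
length-sized zero    zero    = s≤s z≤n
length-sized zero    (suc k) = z≤n
length-sized (suc n) zero    =
  ≤-trans (≤-reflexive (length-map (outside ∷_) (sized n zero))) (length-sized n zero)
length-sized (suc n) (suc k) = begin
  length (map (inside ∷_) (sized n k) List.++ map (outside ∷_) (sized n (suc k)))
    ≡⟨ length-++ (map (inside ∷_) (sized n k)) ⟩
  length (map (inside ∷_) (sized n k)) + length (map (outside ∷_) (sized n (suc k)))
    ≡⟨ cong₂ _+_ (length-map (inside ∷_) (sized n k)) (length-map (outside ∷_) (sized n (suc k))) ⟩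
  length (sized n k) + length (sized n (suc k))  ≤⟨ +-mono-≤ (length-sized n k) (length-sized n (suc k)) ⟩
  n ^ k + n * n ^ k                              ≤⟨ *-monoʳ-≤ (suc n) (^-monoˡ-≤ k (n≤1+n n)) ⟩
  suc n * suc n ^ k                              ∎
  where open ≤-Reasoning

∈-sized : ∀ {n} (p : Subset n) → p ∈ₗ sized n ∣ p ∣
∈-sized []          = here refl
∈-sized (true  ∷ p) = ∈-++⁺ˡ (∈-map⁺ (inside ∷_) (∈-sized p))
∈-sized {suc n} (false ∷ p) with ∣ p ∣ | ∈-sized p
... | zero  | p∈ = ∈-map⁺ (outside ∷_) p∈
... | suc k | p∈ = ∈-++⁺ʳ (map (inside ∷_) (sized n k)) (∈-map⁺ (outside ∷_) p∈)

length-cartesianProduct : ∀ {A B : Set} (xs : List A) (ys : List B) →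
                          length (cartesianProduct xs ys) ≡ length xs * length ys
length-cartesianProduct []       ys = refl
length-cartesianProduct (x ∷ xs) ys =
  trans (length-++ (map (x ,_) ys)) (cong₂ _+_ (length-map (x ,_) ys) (length-cartesianProduct xs ys))

disjoint? : ∀ {n} ((A , B) : Subset n × Subset n) → Dec (A ∩ B ≡ ⊥)
disjoint? (A , B) = ≡-dec _≟ᵇ_ (A ∩ B) ⊥

-- The filter ensures that every mask has exactly `k * k` bits, so that all events of one family
-- have the same probability.
disjointPairs : ∀ n → ℕ → List (Subset n × Subset n)
disjointPairs n k = filter disjoint? (cartesianProduct (sized n k) (sized n k))

events : ∀ n → ℕ → List (Vec Bool (tri n))
events n k = map (uncurry between) (disjointPairs n k)

∈-sized⁻ : ∀ n k {p} → p ∈ₗ sized n k → ∣ p ∣ ≡ k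
∈-sized⁻ zero    zero    (here refl) = refl
∈-sized⁻ (suc n) zero    p∈ with ∈-map⁻ (outside ∷_) p∈
... | _ , p′∈ , refl = ∈-sized⁻ n zero p′∈
∈-sized⁻ (suc n) (suc k) p∈ with ∈-++⁻ (map (inside ∷_) (sized n k)) p∈
... | inj₁ p∈ˡ with _ , p′∈ , refl ← ∈-map⁻ (inside ∷_) p∈ˡ = cong suc (∈-sized⁻ n k p′∈)
... | inj₂ p∈ʳ with _ , p′∈ , refl ← ∈-map⁻ (outside ∷_) p∈ʳ = ∈-sized⁻ n (suc k) p′∈

∈-events : ∀ {n} k {A B : Subset n} → ∣ A ∣ ≡ k → ∣ B ∣ ≡ k → A ∩ B ≡ ⊥ → between A B ∈ₗ events n k
∈-events k {A} {B} refl eq disj =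
  ∈-map⁺ (uncurry between)
    (∈-filter⁺ disjoint?
      (∈-cartesianProduct⁺ (∈-sized A) (subst (λ k → B ∈ₗ sized _ k) eq (∈-sized B))) disj)

events-size : ∀ n k → All (λ t → ∣ t ∣ ≡ k * k) (events n k)
events-size n k = All.tabulate size
  where
  size : ∀ {t} → t ∈ₗ events n k → ∣ t ∣ ≡ k * k
  size t∈ with (A , B) , AB∈ , refl ← ∈-map⁻ (uncurry between) t∈
    with AB∈′ , disj ← ∈-filter⁻ disjoint? {xs = cartesianProduct (sized n k) (sized n k)} AB∈
    with A∈ , B∈ ← ∈-cartesianProduct⁻ (sized n k) (sized n k) AB∈′
    = trans (∣between∣ A B disj) (cong₂ _*_ (∈-sized⁻ n k A∈) (∈-sized⁻ n k B∈))

length-events : ∀ n k → length (events n k) ≤ n ^ k * n ^ k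
length-events n k = begin
  length (events n k)                                        ≡⟨ length-map (uncurry between) (disjointPairs n k) ⟩
  length (disjointPairs n k)                                 ≤⟨ length-filter disjoint? (cartesianProduct (sized n k) (sized n k)) ⟩
  length (cartesianProduct (sized n k) (sized n k))          ≡⟨ length-cartesianProduct (sized n k) (sized n k) ⟩
  length (sized n k) * length (sized n k)                    ≤⟨ *-mono-≤ (length-sized n k) (length-sized n k) ⟩
  n ^ k * n ^ k                                              ∎
  where open ≤-Reasoning

-- The last component measures what remains; in a shattered set it bounds the number of common
-- neighbours from below.
split : ∀ {n} k (p : Subset n) → k ≤ ∣ p ∣ → ∃[ q ] q ⊆ p × ∣ q ∣ ≡ k × ∣ p ∣ ≡ k + ∣ p ─ q ∣
split zero    []          _  = [] , id , refl , refl
split {suc n} k (false ∷ p) k≤ with q , q⊆p , eq , eq′ ← split k p k≤ =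
  outside ∷ q , out⊆ q⊆p , eq , eq′
split {suc n} zero (true ∷ p) k≤ =
  ⊥ , ⊥⊆ , ∣⊥∣≡0 (suc n) , cong ∣_∣ (≡.sym (p─⊥≡p (true ∷ p)))
split {suc n} (suc k) (true ∷ p) (s≤s k≤) with q , q⊆p , eq , eq′ ← split k p k≤ =
  inside ∷ q , in⊆in q⊆p , cong suc eq , cong suc eq′

⊆-∩≡⊥ : ∀ {n} {A A′ B B′ : Subset n} → A′ ⊆ A → B′ ⊆ B → A ∩ B ≡ ⊥ → A′ ∩ B′ ≡ ⊥
⊆-∩≡⊥ A′⊆A B′⊆B disj = ⊆-antisym (λ x∈ → let a , b = x∈p∩q⁻ _ _ x∈ in subst (_ ∈_) disj (x∈p∩q⁺ (A′⊆A a , B′⊆B b))) ⊥⊆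

Constant : ∀ {n} → Graph n → Bool → Subset n → Subset n → Set
Constant G c A B = ∀ a b → a ∈ A → b ∈ B → adj G a b ≡ c

-- For `true` this is the absence of a subgraph K_{k,k}; for `false`, of an empty pair with sides of
-- size k.
NoConstant : ∀ {n} → Graph n → Bool → ℕ → Set
NoConstant {n} G c k = ∀ (A B : Subset n) → A ∩ B ≡ ⊥ → k ≤ ∣ A ∣ → k ≤ ∣ B ∣ → ¬ Constant G c A B

-- A constant pair stays constant when both sides are cut down to exactly `k` vertices, so the
-- finitely many events of size `k` suffice.
avoid-events : ∀ n c k (x : Vec Bool (tri n)) → (∀ {t} → t ∈ₗ events n k → ¬ Mono c t x) →
               NoConstant (graph n x) c k
avoid-events n c k x none A B disj k≤A k≤B const
  with A′ , A′⊆A , eqA , _ ← split k A k≤A | B′ , B′⊆B , eqB , _ ← split k B k≤B =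
  none (∈-events k eqA eqB (⊆-∩≡⊥ A′⊆A B′⊆B disj))
       (Mono-between A′ B′ x λ a b a∈ b∈ → const a b (A′⊆A a∈) (B′⊆B b∈))

random-graph : ∀ n r s m →
               2 * (n ^ s * n ^ s) < suc r ^ (s * s) →
               2 * (n ^ m * n ^ m * r ^ (m * m)) ≤ suc r ^ (m * m) →
               ∃[ G ] (NoConstant {n} G true s × NoConstant G false m)
random-graph n r s m few few′ =
  let x , none , none′ = avoid r (s * s) (m * m) (events n s) (events n m) (events-size n s) (events-size n m)
        (≤-<-trans (*-monoʳ-≤ 2 (length-events n s)) few)
        (≤-trans (*-monoʳ-≤ 2 (*-monoˡ-≤ (r ^ (m * m)) (length-events n m))) few′)
  in graph n x , avoid-events n true s x none , avoid-events n false m x none′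

-- Shattered sets

∣─⁅⁆∣ : ∀ {n} (p : Subset n) {x} → x ∈ p → ∣ p ∣ ≡ suc ∣ p - x ∣
∣─⁅⁆∣ (true  ∷ p) Vec.here       = cong (suc ∘ ∣_∣) (≡.sym (p─⊥≡p p))
∣─⁅⁆∣ (true  ∷ p) (Vec.there x∈) = cong suc (∣─⁅⁆∣ p x∈)
∣─⁅⁆∣ (false ∷ p) (Vec.there x∈) = ∣─⁅⁆∣ p x∈

x∈p─q⇒x∉q : ∀ {n} (p q : Subset n) {x} → x ∈ p ─ q → x ∉ q
x∈p─q⇒x∉q (_ ∷ p) (true  ∷ q) {suc x} (Vec.there x∈) (Vec.there x∈q) = x∈p─q⇒x∉q p q x∈ x∈q
x∈p─q⇒x∉q (_ ∷ p) (false ∷ q) {suc x} (Vec.there x∈) (Vec.there x∈q) = x∈p─q⇒x∉q p q x∈ x∈q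

-- Induction on the size, removing some `x` from `p` and `f x` from `q`; injectivity on `p` keeps
-- the other images inside the reduced `q`.
injection⇒∣∣≤∣∣ : ∀ {n} k {p q : Subset n} → ∣ p ∣ ≡ k → (f : Fin n → Fin n) →
                 (∀ x y → x ∈ p → y ∈ p → f x ≡ f y → x ≡ y) →
                 (∀ x → x ∈ p → f x ∈ q) → k ≤ ∣ q ∣
injection⇒∣∣≤∣∣ zero    _  f inj f∈ = z≤n
injection⇒∣∣≤∣∣ {n} (suc k) {p} {q} eq f inj f∈ with nonempty? p
... | no  empty = contradiction (trans (≡.sym eq) (trans (cong ∣_∣ (Empty-unique empty)) (∣⊥∣≡0 n))) λ ()
... | yes (x , x∈p) = subst (suc k ≤_) (≡.sym (∣─⁅⁆∣ q (f∈ x x∈p)))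
  (s≤s (injection⇒∣∣≤∣∣ k {p - x} {q - f x} (suc-injective (trans (≡.sym (∣─⁅⁆∣ p x∈p)) eq)) f
    (λ y z y∈ z∈ → inj y z (p─q⊆p p ⁅ x ⁆ y∈) (p─q⊆p p ⁅ x ⁆ z∈))
    (λ y y∈ → x∈p∧x≢y⇒x∈p-y (f∈ y (p─q⊆p p ⁅ x ⁆ y∈)) λ fy≡fx →
      x∈p─q⇒x∉q p ⁅ x ⁆ y∈ (subst (_∈ ⁅ x ⁆) (≡.sym (inj y x (p─q⊆p p ⁅ x ⁆ y∈) x∈p fy≡fx)) (x∈⁅x⁆ x)))))

∈-tabulate⁺ : ∀ {n} (f : Fin n → Bool) {x} → f x ≡ true → x ∈ tabulate f
∈-tabulate⁺ f {x} eq = lookup⇒[]= x (tabulate f) (trans (lookup∘tabulate f x) eq)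

∈-tabulate⁻ : ∀ {n} (f : Fin n → Bool) {x} → x ∈ tabulate f → f x ≡ true
∈-tabulate⁻ f {x} x∈ = trans (≡.sym (lookup∘tabulate f x)) ([]=⇒lookup x∈)

commonNeighbours : ∀ {n} → Graph n → Subset n → Subset n
commonNeighbours G T = tabulate λ v → does (T ⊆? N G v)

∈-commonNeighbours⁺ : ∀ {n} (G : Graph n) T {v} → T ⊆ N G v → v ∈ commonNeighbours G T
∈-commonNeighbours⁺ G T {v} T⊆N = ∈-tabulate⁺ _ (dec-true (T ⊆? N G v) T⊆N)

∈-commonNeighbours⁻ : ∀ {n} (G : Graph n) T {v} → v ∈ commonNeighbours G T → T ⊆ N G v
∈-commonNeighbours⁻ G T {v} v∈ with T ⊆? N G v | ∈-tabulate⁻ (λ v → does (T ⊆? N G v)) v∈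
... | yes T⊆N | _ = T⊆N
... | no  _   | ()

-- The vertices whose traces on S are T and T ∪ {x}, for x ∈ S ∖ T, are distinct.
shattered⇒commonNeighbours : ∀ {n} (G : Graph n) {S T : Subset n} → Shattered G S → T ⊆ S →
                             ∣ S ─ T ∣ < ∣ commonNeighbours G T ∣
shattered⇒commonNeighbours {n} G {S} {T} sh T⊆S =
  subst (∣ S ─ T ∣ <_) (≡.sym (∣─⁅⁆∣ W v₀∈W))
    (s≤s (injection⇒∣∣≤∣∣ ∣ S ─ T ∣ {S ─ T} {W - v₀} refl f f-injective λ x x∈ → x∈p∧x≢y⇒x∈p-y (f∈W x) (f≢v₀ x x∈)))
  where
  W = commonNeighbours G T
  v₀ = proj₁ (sh T T⊆S)
  v₀-trace : N G v₀ ∩ S ≡ T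
  v₀-trace = proj₂ (sh T T⊆S)
  trace-of : Fin n → Subset n
  -- The intersection with `S` gives an admissible trace for every `x`, so `f` can be total; for `x`
  -- in `S` it equals `T ∪ ⁅ x ⁆`.
  trace-of x = (T ∪ ⁅ x ⁆) ∩ S
  f : Fin n → Fin n
  f x = proj₁ (sh (trace-of x) (p∩q⊆q (T ∪ ⁅ x ⁆) S))
  f-trace : ∀ x → N G (f x) ∩ S ≡ trace-of x
  f-trace x = proj₂ (sh (trace-of x) (p∩q⊆q (T ∪ ⁅ x ⁆) S))
  v₀∈W : v₀ ∈ W
  v₀∈W = ∈-commonNeighbours⁺ G T λ t∈ → p∩q⊆p (N G v₀) S (subst (_ ∈_) (≡.sym v₀-trace) t∈)
  f∈W : ∀ x → f x ∈ W
  f∈W x = ∈-commonNeighbours⁺ G T λ t∈ → p∩q⊆p (N G (f x)) S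
    (subst (_ ∈_) (≡.sym (f-trace x)) (x∈p∩q⁺ (p⊆p∪q ⁅ x ⁆ t∈ , T⊆S t∈)))
  x∈trace : ∀ x → x ∈ S ─ T → x ∈ N G (f x) ∩ S
  x∈trace x x∈ = subst (x ∈_) (≡.sym (f-trace x)) (x∈p∩q⁺ (q⊆p∪q T ⁅ x ⁆ (x∈⁅x⁆ x) , p─q⊆p S T x∈))
  f≢v₀ : ∀ x → x ∈ S ─ T → f x ≢ v₀
  f≢v₀ x x∈ eq = x∈p─q⇒x∉q S T x∈
    (subst (x ∈_) (trans (cong (λ v → N G v ∩ S) eq) v₀-trace) (x∈trace x x∈))
  f-injective : ∀ x y → x ∈ S ─ T → y ∈ S ─ T → f x ≡ f y → x ≡ y
  f-injective x y x∈ y∈ eq with x∈p∪q⁻ T ⁅ y ⁆ (p∩q⊆p (T ∪ ⁅ y ⁆) S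
    (subst (x ∈_) (trans (cong (λ v → N G v ∩ S) eq) (f-trace y)) (x∈trace x x∈)))
  ... | inj₁ x∈T = contradiction x∈T (x∈p─q⇒x∉q S T x∈)
  ... | inj₂ x∈y = x∈⁅y⁆⇒x≡y y x∈y

NoConstant⇒VCdim≤ : ∀ {n} (G : Graph n) {s d} → s + s ≤ 2 + d → NoConstant G true s → VCdim≤ G d
NoConstant⇒VCdim≤ {n} G {s} {d} 2s≤ none S sh = ≮⇒≥ λ d<S →
  let T , T⊆S , ∣T∣≡s , ∣S∣≡ = split s S (s≤∣S∣ 2s≤ d<S)
      W = commonNeighbours G T
      s≤W : s ≤ ∣ W ∣
      -- From 2s ≤ d + 2 ≤ ∣S∣ + 1, at least s - 1 points of `S` lie outside `T`; the strict
      -- inequality for common neighbours supplies the missing one.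
      s≤W = ≤-trans (+-cancelˡ-≤ s s (suc ∣ S ─ T ∣) (begin
        s + s                  ≤⟨ 2s≤ ⟩
        suc (suc d)            ≤⟨ s≤s d<S ⟩
        suc ∣ S ∣              ≡⟨ cong suc ∣S∣≡ ⟩
        suc (s + ∣ S ─ T ∣)    ≡⟨ +-suc s _ ⟨
        s + suc ∣ S ─ T ∣      ∎)) (shattered⇒commonNeighbours G sh T⊆S)
      T⊆N : ∀ {v} → v ∈ W → T ⊆ N G v
      T⊆N = ∈-commonNeighbours⁻ G T
      disjoint : ∀ {v} → v ∈ T ∩ W → v ∈ ⊥
      -- A vertex of `T` that is a common neighbour of `T` would be adjacent to itself.
      disjoint {v} v∈ = let v∈T , v∈W = x∈p∩q⁻ T W v∈ in
        contradiction (trans (≡.sym (irrefl G v)) (∈-tabulate⁻ (adj G v) (T⊆N v∈W v∈T))) λ ()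
  in none T W (⊆-antisym disjoint ⊥⊆) (≤-reflexive (≡.sym ∣T∣≡s)) s≤W
       λ a b a∈ b∈ → trans (Graph.sym G a b) (∈-tabulate⁻ (adj G b) (T⊆N b∈ a∈))
  where
  open ≤-Reasoning
  s≤∣S∣ : ∀ {s} → s + s ≤ 2 + d → d < ∣ S ∣ → s ≤ ∣ S ∣
  s≤∣S∣ {zero}  _               _   = z≤n
  s≤∣S∣ {suc s} (s≤s s+1+s≤1+d) d<S = ≤-trans (≤-trans (m≤n+m (suc s) s) s+1+s≤1+d) d<S

-- Choice of the parameters

open ≤-Reasoning

-- Walks down from `k` to a place where `P` switches from false to true; for the monotone predicates
-- used below this is the threshold.
first : ∀ {P : ℕ → Set} → Decidable P → ¬ P 0 → ∀ k → P k → ∃[ r ] ¬ P r × P (suc r)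
first P? ¬P0 zero    Pk = contradiction Pk ¬P0
first P? ¬P0 (suc k) Pk with P? k
... | yes Pk′ = first P? ¬P0 k Pk′
... | no ¬Pk  = k , ¬Pk , Pk

^-distribʳ-* : ∀ a b k → (a * b) ^ k ≡ a ^ k * b ^ k
^-distribʳ-* a b zero    = refl
^-distribʳ-* a b (suc k) = trans (cong (a * b *_) (^-distribʳ-* a b k)) (lemma a b (a ^ k) (b ^ k))
  where
  lemma : ∀ a b c d → a * b * (c * d) ≡ a * c * (b * d)
  lemma = solve-∀

n<2^n : ∀ n → n < 2 ^ n
n<2^n zero    = s≤s z≤n
n<2^n (suc n) = begin-strict
  suc n            <⟨ +-mono-≤-< (≤-<-trans z≤n (n<2^n n)) (n<2^n n) ⟩
  2 ^ n + 2 ^ n    ≡⟨ cong (2 ^ n +_) (+-identityʳ _) ⟨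
  2 ^ suc n        ∎

^-cancelʳ-< : ∀ k {a b} → a ^ k < b ^ k → a < b
^-cancelʳ-< k a^k<b^k = ≰⇒> λ b≤a → <⇒≱ a^k<b^k (^-monoˡ-≤ k b≤a)

log₂ : ∀ n → 1 ≤ n → ∃[ l ] 2 ^ l ≤ n × n < 2 ^ suc l
log₂ n 1≤n =
  let l , ¬n<2^l , n<2^1+l = first (λ k → n <? 2 ^ k) (≤⇒≯ 1≤n) n (n<2^n n)
  in l , ≮⇒≥ ¬n<2^l , n<2^1+l

-- Here `suc r` is the d-th root of `N` rounded up; the search may start at `N` because `N ≤ N ^ d`.
ceilRoot : ∀ d N → 1 ≤ d → 1 ≤ N → ∃[ r ] r ^ d < N × N ≤ suc r ^ d
ceilRoot (suc d) N@(suc _) 1≤d 1≤N =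
  let r , ¬N≤r^d , N≤q^d = first (λ q → N ≤? q ^ suc d) (λ ()) N (m≤m*n N (N ^ d) {{m^n≢0 N d}})
  in r , ≰⇒> ¬N≤r^d , N≤q^d

-- The witness is ⌊d/2⌋ + 1. The upper bound serves the VC-dimension, the lower one the count of
-- copies of K_{s,s}.
half : ∀ d → ∃[ s ] s + s ≤ 2 + d × suc d ≤ s + s
half zero          = 1 , ≤-refl , s≤s z≤n
half (suc zero)    = 1 , s≤s (s≤s z≤n) , ≤-refl
half (suc (suc d)) =
  let s , s+s≤ , ≤s+s = half d
      eq = cong suc (≡.sym (+-suc s s))
  in suc s , subst (_≤ 4 + d) eq (s≤s (s≤s s+s≤)) , subst (3 + d ≤_) eq (s≤s (s≤s ≤s+s))

-- Bernoulli's inequality (1 + 1/r)^k ≥ 1 + k/r, multiplied by r^(k+1).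
bernoulli : ∀ r k → r ^ k * (r + k) ≤ r * suc r ^ k
bernoulli r zero    = ≤-reflexive (lemma r)
  where
  lemma : ∀ r → 1 * (r + 0) ≡ r * 1
  lemma = solve-∀
bernoulli r (suc k) = begin
  r * r ^ k * (r + suc k)                   ≤⟨ m≤m+n _ (r ^ k * k) ⟩
  r * r ^ k * (r + suc k) + r ^ k * k       ≡⟨ lemma r (r ^ k) k ⟩
  suc r * (r ^ k * (r + k))                 ≤⟨ *-monoʳ-≤ (suc r) (bernoulli r k) ⟩
  suc r * (r * suc r ^ k)                   ≡⟨ lemma′ (suc r) r (suc r ^ k) ⟩
  r * suc r ^ suc k                         ∎
  where
  lemma : ∀ r a k → r * a * (r + suc k) + a * k ≡ suc r * (a * (r + k))
  lemma = solve-∀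
  lemma′ : ∀ a b c → a * (b * c) ≡ b * (a * c)
  lemma′ = solve-∀

-- This is (1 - 1/q)^q ≤ 1/2 for q = r + 1, from Bernoulli's inequality with exponent `r`.
2*r^q≤q^q : ∀ r → 2 * r ^ suc r ≤ suc r ^ suc r
2*r^q≤q^q r = begin
  2 * (r * r ^ r)          ≡⟨ lemma r (r ^ r) ⟩
  r ^ r * (r + r)          ≤⟨ bernoulli r r ⟩
  r * suc r ^ r            ≤⟨ *-monoˡ-≤ (suc r ^ r) (n≤1+n r) ⟩
  suc r * suc r ^ r        ∎
  where
  lemma : ∀ r a → 2 * (r * a) ≡ a * (r + r)
  lemma = solve-∀

-- Both sides are raised to the power `d`, since `q` is controlled only through `q ^ d`. The factor
-- 2 is absorbed into one more factor `n`, whence the exponent 2s + 1.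
few-complete : ∀ n q d s → 2 ≤ n → n ^ 4 ≤ q ^ d → suc d ≤ s + s → 2 * (n ^ s * n ^ s) < q ^ (s * s)
few-complete n q d s 2≤n n^4≤q^d d<s+s = ^-cancelʳ-< d (begin-strict
  (2 * (n ^ s * n ^ s)) ^ d     ≤⟨ ^-monoˡ-≤ d (*-monoˡ-≤ (n ^ s * n ^ s) 2≤n) ⟩
  (n * (n ^ s * n ^ s)) ^ d     ≡⟨ cong (λ z → (n * z) ^ d) (^-distribˡ-+-* n s s) ⟨
  (n ^ suc (s + s)) ^ d         ≡⟨ ^-*-assoc n (suc (s + s)) d ⟩
  n ^ (suc (s + s) * d)         <⟨ ^-monoʳ-< n 2≤n exponent ⟩
  n ^ (4 * (s * s))             ≡⟨ ^-*-assoc n 4 (s * s) ⟨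
  (n ^ 4) ^ (s * s)             ≤⟨ ^-monoˡ-≤ (s * s) n^4≤q^d ⟩
  (q ^ d) ^ (s * s)             ≡⟨ ^-*-assoc q d (s * s) ⟩
  q ^ (d * (s * s))             ≡⟨ cong (q ^_) (*-comm d (s * s)) ⟩
  q ^ (s * s * d)               ≡⟨ ^-*-assoc q (s * s) d ⟨
  (q ^ (s * s)) ^ d             ∎)
  where
  -- (2s + 1)(2s − 1) < 4s²
  exponent : suc (s + s) * d < 4 * (s * s)
  exponent = +-cancelʳ-< (suc (s + s)) _ _ (begin-strict
    suc (s + s) * d + suc (s + s)    ≡⟨ lemma (s + s) d ⟩
    suc (s + s) * suc d              ≤⟨ *-monoʳ-≤ (suc (s + s)) d<s+s ⟩
    suc (s + s) * (s + s)            <⟨ n<1+n _ ⟩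
    suc (suc (s + s) * (s + s))      ≡⟨ lemma′ s ⟩
    4 * (s * s) + suc (s + s)        ∎)
    where
    lemma : ∀ a b → suc a * b + suc a ≡ suc a * suc b
    lemma = solve-∀
    lemma′ : ∀ s → suc (suc (s + s) * (s + s)) ≡ 4 * (s * s) + suc (s + s)
    lemma′ = solve-∀

few-empty : ∀ n r l → n < 2 ^ suc l → let m = suc r * (3 + (l + l)) in
            2 * (n ^ m * n ^ m * r ^ (m * m)) ≤ suc r ^ (m * m)
few-empty n r l n<2^1+l = begin
  -- With 2 enlarged to `2 ^ m` everything is an m-th power, and it remains to compare 2n²(1 -
  -- 1/q)^m with 1, where m = qL.
  2 * (n ^ m * n ^ m * r ^ (m * m))            ≤⟨ *-monoˡ-≤ _ (^-monoʳ-≤ 2 {1} {m} (s≤s z≤n)) ⟩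
  2 ^ m * (n ^ m * n ^ m * r ^ (m * m))        ≡⟨ cong₂ (λ a b → 2 ^ m * (a * b)) (^-distribʳ-* n n m) (^-*-assoc r m m) ⟨
  2 ^ m * ((n * n) ^ m * (r ^ m) ^ m)          ≡⟨ cong (2 ^ m *_) (^-distribʳ-* (n * n) (r ^ m) m) ⟨
  2 ^ m * (n * n * r ^ m) ^ m                  ≡⟨ ^-distribʳ-* 2 (n * n * r ^ m) m ⟨
  (2 * (n * n * r ^ m)) ^ m                    ≡⟨ cong (_^ m) (*-assoc 2 (n * n) (r ^ m)) ⟨
  (2 * (n * n) * r ^ m) ^ m                    ≤⟨ ^-monoˡ-≤ m (*-monoˡ-≤ (r ^ m) 2n²≤2^L) ⟩
  (2 ^ L * r ^ m) ^ m                          ≡⟨ cong (λ z → (2 ^ L * z) ^ m) (^-*-assoc r (suc r) L) ⟨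
  (2 ^ L * (r ^ suc r) ^ L) ^ m                ≡⟨ cong (_^ m) (^-distribʳ-* 2 (r ^ suc r) L) ⟨
  ((2 * r ^ suc r) ^ L) ^ m                    ≤⟨ ^-monoˡ-≤ m (^-monoˡ-≤ L (2*r^q≤q^q r)) ⟩
  ((suc r ^ suc r) ^ L) ^ m                    ≡⟨ cong (_^ m) (^-*-assoc (suc r) (suc r) L) ⟩
  (suc r ^ m) ^ m                              ≡⟨ ^-*-assoc (suc r) m m ⟩
  suc r ^ (m * m)                              ∎
  where
  L m : ℕ
  -- Two factors n < 2^(l+1) and the factor 2 give the exponent 2(l + 1) + 1.
  L = 3 + (l + l)
  m = suc r * L
  2n²≤2^L : 2 * (n * n) ≤ 2 ^ L
  2n²≤2^L = begin
    2 * (n * n)                     ≤⟨ *-monoʳ-≤ 2 (*-mono-≤ (<⇒≤ n<2^1+l) (<⇒≤ n<2^1+l)) ⟩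
    2 * (2 ^ suc l * 2 ^ suc l)     ≡⟨ cong (2 *_) (^-distribˡ-+-* 2 (suc l) (suc l)) ⟨
    2 ^ (2 + (l + suc l))           ≡⟨ cong (λ z → 2 ^ (2 + z)) (+-suc l l) ⟩
    2 ^ L                           ∎

-- With k = ⌊l/d⌋ ≥ d one has l < (k + 1)k, so 2l + 3 is below a quadratic in k and hence below
-- 16^k; the d-th power is then below 16^(kd). It serves to show L < q.
growth : ∀ d l → 1 ≤ d → d * d ≤ l → (3 + (l + l)) ^ d < 16 ^ l
growth d@(suc d-1) l 1≤d d²≤l = begin-strict
  (3 + (l + l)) ^ d      <⟨ ^-monoˡ-< d base ⟩
  (16 ^ k) ^ d           ≡⟨ ^-*-assoc 16 k d ⟩
  16 ^ (k * d)           ≤⟨ ^-monoʳ-≤ 16 (m/n*n≤m l d) ⟩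
  16 ^ l                 ∎
  where
  k = l / d
  d≤k : d ≤ k
  d≤k = subst (_≤ k) (m*n/n≡m d d) (/-monoˡ-≤ d d²≤l)
  l<[1+k]k : l < suc k * k
  l<[1+k]k = begin-strict
    l                    ≡⟨ m≡m%n+[m/n]*n l d ⟩
    _ + k * d            <⟨ +-monoˡ-< (k * d) (m%n<n l d) ⟩
    suc k * d            ≤⟨ *-monoʳ-≤ (suc k) d≤k ⟩
    suc k * k            ∎
  base : 3 + (l + l) < 16 ^ k
  base = begin-strict
    3 + (l + l)                              ≡⟨ cong (2 +_) (+-suc l l) ⟨
    suc (suc l + suc l)                      ≤⟨ s≤s (+-mono-≤ l<[1+k]k l<[1+k]k) ⟩
    suc (suc k * k + suc k * k)              <⟨ m≤m+n _ _ ⟩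
    -- The added polynomial completes the sum to 4(k + 1)², which is at most (k + 1)⁴ as k ≥ 1.
    suc (suc (suc k * k + suc k * k)) + (2 + 6 * k + 2 * (k * k))
                                             ≡⟨ lemma k ⟩
    4 * (suc k * suc k)                      ≤⟨ *-mono-≤ (*-mono-≤ 2≤1+k 2≤1+k) ≤-refl ⟩
    suc k * suc k * (suc k * suc k)          ≤⟨ *-mono-≤ (*-mono-≤ k<2^k k<2^k) (*-mono-≤ k<2^k k<2^k) ⟩
    2 ^ k * 2 ^ k * (2 ^ k * 2 ^ k)          ≡⟨ cong₂ _*_ (^-distribʳ-* 2 2 k) (^-distribʳ-* 2 2 k) ⟨
    4 ^ k * 4 ^ k                            ≡⟨ ^-distribʳ-* 4 4 k ⟨
    16 ^ k                                   ∎
    where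
    k<2^k = n<2^n k
    2≤1+k : 2 ≤ suc k
    2≤1+k = s≤s (≤-trans 1≤d d≤k)
    lemma : ∀ k → suc (suc (suc k * k + suc k * k)) + (2 + 6 * k + 2 * (k * k)) ≡ 4 * (suc k * suc k)
    lemma = solve-∀

-- As (4/3)² ≤ 2, that is 16 ≤ 18, raising the exponent by 2 costs at most one factor 2.
4^≤3^*2^-+ : ∀ m l k → 4 ^ m ≤ 3 ^ m * 2 ^ l → 4 ^ (m + 2 * k) ≤ 3 ^ (m + 2 * k) * 2 ^ (l + k)
4^≤3^*2^-+ m l k 4^m≤ = begin
  4 ^ (m + 2 * k)                        ≡⟨ expand 4 ⟩
  4 ^ m * 16 ^ k                         ≤⟨ *-mono-≤ 4^m≤ (^-monoˡ-≤ k (m≤m+n 16 2)) ⟩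
  3 ^ m * 2 ^ l * 18 ^ k                 ≡⟨ cong (3 ^ m * 2 ^ l *_) (^-distribʳ-* 9 2 k) ⟩
  3 ^ m * 2 ^ l * (9 ^ k * 2 ^ k)        ≡⟨ lemma (3 ^ m) (2 ^ l) (9 ^ k) (2 ^ k) ⟩
  3 ^ m * 9 ^ k * (2 ^ l * 2 ^ k)        ≡⟨ cong₂ _*_ (expand 3) (^-distribˡ-+-* 2 l k) ⟨
  3 ^ (m + 2 * k) * 2 ^ (l + k)          ∎
  where
  lemma : ∀ a b c d → a * b * (c * d) ≡ a * c * (b * d)
  lemma = solve-∀
  expand : ∀ b → b ^ (m + 2 * k) ≡ b ^ m * (b ^ 2) ^ k
  expand b = trans (^-distribˡ-+-* b m (2 * k)) (cong (b ^ m *_) (≡.sym (^-*-assoc b 2 k)))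

-- Base case by evaluation: 10 is the least l with (4/3)^(2l+4) ≤ 2^l.
4^24≤3^24*2^10 : 4 ^ 24 ≤ 3 ^ 24 * 2 ^ 10
4^24≤3^24*2^10 = ≤ᵇ⇒≤ (4 ^ 24) (3 ^ 24 * 2 ^ 10) _

4^≤3^*2^ : ∀ l → 10 ≤ l → 4 ^ (4 + (l + l)) ≤ 3 ^ (4 + (l + l)) * 2 ^ l
4^≤3^*2^ l 10≤l =
  subst₂ (λ e f → 4 ^ e ≤ 3 ^ e * 2 ^ f) exponent (m+[n∸m]≡n 10≤l)
    (4^≤3^*2^-+ 24 10 (l ∸ 10) 4^24≤3^24*2^10)
  where
  lemma : ∀ k → 24 + 2 * k ≡ 4 + ((10 + k) + (10 + k))
  lemma = solve-∀
  exponent : 24 + 2 * (l ∸ 10) ≡ 4 + (l + l)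
  exponent = trans (lemma (l ∸ 10)) (cong (λ z → 4 + (z + z)) (m+[n∸m]≡n 10≤l))

-- The hypotheses give a ≥ r(L + 1). The spare 1 in L + 1 pays for rounding the root up from `r` to
-- `suc r`, because L ≤ r.
root-bound : ∀ d r L a N → 1 ≤ d → L ≤ r → r ^ d < N → suc L ^ d * N ≤ a ^ d → suc r * L ≤ a
root-bound d r L a N 1≤d L≤r r^d<N ≤a^d = ≤-trans qL≤ (≮⇒≥ λ a< → <⇒≱ (^-monoˡ-< d {{>-nonZero 1≤d}} a<) (begin
  (r * suc L) ^ d        ≡⟨ ^-distribʳ-* r (suc L) d ⟩
  r ^ d * suc L ^ d      ≡⟨ *-comm (r ^ d) _ ⟩
  suc L ^ d * r ^ d      ≤⟨ *-monoʳ-≤ (suc L ^ d) (<⇒≤ r^d<N) ⟩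
  suc L ^ d * N          ≤⟨ ≤a^d ⟩
  a ^ d                  ∎))
  where
  qL≤ : suc r * L ≤ r * suc L
  qL≤ = begin
    L + r * L      ≤⟨ +-monoˡ-≤ (r * L) L≤r ⟩
    r + r * L      ≡⟨ *-suc r L ⟨
    r * suc L      ∎

2^k≤n<2^1+l⇒k≤l : ∀ {k l n} → 2 ^ k ≤ n → n < 2 ^ suc l → k ≤ l
2^k≤n<2^1+l⇒k≤l {k} {l} 2^k≤n n<2^1+l = ≮⇒≥ λ l<k → <⇒≱ n<2^1+l (≤-trans (^-monoʳ-≤ 2 l<k) 2^k≤n)

theorem6 : (d : ℕ) → 5 ≤ d →
    ∃[ N₀ ] ∀ (n : ℕ) → N₀ ≤ n →
    ∃[ G ] (VCdim≤ {n} G d ×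
    (∀ (A B : Subset n) → A ∩ B ≡ ⊥ →
    Large d n ∣ A ∣ → Large d n ∣ B ∣ → ¬ Homogeneous G A B))
-- This threshold gives d² ≤ l = ⌊log₂ n⌋, as `growth` demands; since d ≥ 5 it also gives l ≥ 10.
theorem6 d 5≤d = 2 ^ (d * d) , λ n 2^d²≤n →
  let 2≤n = ≤-trans (^-monoʳ-≤ 2 1≤d²) 2^d²≤n
      1≤n = ≤-trans (s≤s z≤n) 2≤n
      l , 2^l≤n , n<2^1+l = log₂ n 1≤n
      r , r^d<n⁴ , n⁴≤q^d = ceilRoot d (n ^ 4) 1≤d (m^n>0 n {{>-nonZero 1≤n}} 4)
      s , 2s≤2+d , 1+d≤2s = half d
      d²≤l = 2^k≤n<2^1+l⇒k≤l {d * d} {l} 2^d²≤n n<2^1+l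
      L = 3 + (l + l)
      m = suc r * L
      -- L^d < 16^l ≤ n⁴ ≤ q^d, hence L < q = r + 1.
      L≤r = ≤-pred (^-cancelʳ-< d (<-≤-trans (growth d l 1≤d d²≤l) (≤-trans (16^l≤n⁴ l n 2^l≤n) n⁴≤q^d)))
      -- Through s ≤ d ≤ d² ≤ l ≤ L ≤ m, the exclusion of K_{s,s} also covers complete pairs with
      -- sides of size at least m.
      s≤m = ≤-trans (s≤d s 2s≤2+d) (≤-trans (≤-trans d≤d² d²≤l) (≤-trans (m≤n+m l (3 + l)) (m≤n*m L (suc r))))
      G , noComplete , noEmpty = random-graph n r s m
        (few-complete n (suc r) d s 2≤n n⁴≤q^d 1+d≤2s) (few-empty n r l n<2^1+l)
      large⇒m≤ : ∀ a → Large d n a → m ≤ a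
      large⇒m≤ a large = root-bound d r L a (n ^ 4) 1≤d L≤r r^d<n⁴
        -- The exponent is (L + 1)/4 = (2l + 4)/4, and (4/3)^(2l+4) ≤ 2^l ≤ n.
        (Large⇒≥ d n a L large
          (≤-trans (4^≤3^*2^ l (≤-trans 10≤d² d²≤l)) (*-monoʳ-≤ (3 ^ suc L) 2^l≤n)))
  in G , NoConstant⇒VCdim≤ G 2s≤2+d noComplete , λ where
    A B disjoint largeA largeB (inj₁ complete) → noComplete A B disjoint
      (≤-trans s≤m (large⇒m≤ ∣ A ∣ largeA)) (≤-trans s≤m (large⇒m≤ ∣ B ∣ largeB)) complete
    A B disjoint largeA largeB (inj₂ empty) → noEmpty A B disjoint
      (large⇒m≤ ∣ A ∣ largeA) (large⇒m≤ ∣ B ∣ largeB) empty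
  where
  1≤d : 1 ≤ d
  1≤d = ≤-trans (s≤s z≤n) 5≤d
  d≤d² : d ≤ d * d
  d≤d² = m≤m*n d d {{>-nonZero 1≤d}}
  10≤d² : 10 ≤ d * d
  10≤d² = ≤-trans (m≤m+n 10 15) (*-mono-≤ 5≤d 5≤d)
  1≤d² : 1 ≤ d * d
  1≤d² = ≤-trans 1≤d d≤d²
  16^l≤n⁴ : ∀ l n → 2 ^ l ≤ n → 16 ^ l ≤ n ^ 4
  16^l≤n⁴ l n 2^l≤n = begin
    16 ^ l          ≡⟨ ^-*-assoc 2 4 l ⟩
    2 ^ (4 * l)     ≡⟨ cong (2 ^_) (*-comm 4 l) ⟩
    2 ^ (l * 4)     ≡⟨ ^-*-assoc 2 l 4 ⟨
    (2 ^ l) ^ 4     ≤⟨ ^-monoˡ-≤ 4 2^l≤n ⟩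
    n ^ 4           ∎
  s≤d : ∀ s → s + s ≤ 2 + d → s ≤ d
  s≤d s s+s≤2+d = ≮⇒≥ λ d<s → <⇒≱ (begin-strict
    2 + d               <⟨ m≤n+m (3 + d) (pred d) ⟩
    pred d + (3 + d)    ≡⟨ lemma d 1≤d ⟩
    suc d + suc d       ≤⟨ +-mono-≤ d<s d<s ⟩
    s + s               ∎) s+s≤2+d
    where
    lemma : ∀ d → 1 ≤ d → pred d + (3 + d) ≡ suc d + suc d
    lemma (suc d) _ = trans (+-suc d (3 + d)) (cong suc (+-suc d (2 + d)))
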